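{- Let $ufe$ be a union-find-explain data structure and $x,y\in\mathbb{N}$. If $(x,y)\in\mathsf{equivcl}(\mathsf{set}(\mathsf{unions}\ ufe))$, then $\mathsf{unions}\ ufe\vdash_{=}\mathsf{explain}\ ufe\ x\ y:(x,y)$.
   Context: Union-find (UF) data structures. A UF data structure $uf$ is a finite list $l$ of natural numbers, of length $n$, such that for every $i<n$ we have $l\,!\,i<n$ (the parent of $i$) and following parents from $i$ eventually reaches a root, i.e. an index $j$ with $l\,!\,j=j$. For $i<n$, $\mathsf{ufa\_rep\_of}\ uf\ i$ is that root $j$ (for $i\ge n$ the value is some unspecified number). The represented partial equivalence relation is $\mathsf{ufa\_\alpha}\ uf=\{(x,y)\mid x,y<n,\ \mathsf{ufa\_rep\_of}\ uf\ x=\mathsf{ufa\_rep\_of}\ uf\ y\}$; its field is $\{0,\dots,n-1\}$. For $x,y<n$, $\mathsf{ufa\_union}\ uf\ x\ y$ is the list obtained from $l$ by setting the entry at index $\mathsf{ufa\_rep\_of}\ uf\ x$ to $\mathsf{ufa\_rep\_of}\ uf\ y$. $\mathsf{eff\_union}\ uf\ a\ b$ means $a,b\in\mathrm{Field}(\mathsf{ufa\_\alpha}\ uf)$ and $\mathsf{ufa\_rep\_of}\ uf\ a\neq\mathsf{ufa\_rep\_of}\ uf\ b$. $\mathsf{ufa\_unions}\ uf\ us$ performs the unions in the list of pairs $us$ from left to right, and $\mathsf{eff\_unions}\ uf\ us$ means that each pair in $us$ is an effective union with respect to the UF data structure resulting from $uf$ by performing all preceding unions of $us$. Union-find-explain (UFE)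 data structures. A UFE data structure $ufe$ is a pair $(uf,us)$ with $\mathsf{ufa\_\alpha}\ uf\subseteq\mathrm{Id}$ and $\mathsf{eff\_unions}\ uf\ us$. Put $\mathsf{unions}\ ufe=us$, $\mathsf{uf\_ds}\ ufe=\mathsf{ufa\_unions}\ uf\ us$, $\mathsf{ufe\_rep\_of}\ ufe=\mathsf{ufa\_rep\_of}(\mathsf{uf\_ds}\ ufe)$; $\mathsf{rollback}\ ufe$ removes the last pair from $us$. Proofs. $\mathsf{set}\ us$ is the set of elements of $us$. $\mathsf{equivcl}\ r=(r\cup r^{ -1})^{*}$ (reflexive transitive closure, reflexive on all of $\mathbb{N}$). Proof terms are generated by $\mathsf{AssmP}\ i$, $\mathsf{ReflP}\ x$, $\mathsf{SymP}\ p$, $p_1\bigtriangledown p_2$. The judgement $us\vdash_{=}p:(x,y)$ is inductively defined by: $us\vdash_{=}\mathsf{AssmP}\ i:(x,y)$ if $i<|us|$ and $us\,!\,i=(x,y)$ (0-indexed); $us\vdash_{=}\mathsf{ReflP}\ x:(x,x)$; $us\vdash_{=}\mathsf{SymP}\ p:(y,x)$ if $us\vdash_{=}p:(x,y)$; $us\vdash_{=}p_1\bigtriangledown p_2:(x,z)$ if $us\vdash_{=}p_1:(x,y)$ and $us\vdash_{=}p_2:(y,z)$. Repeated $\bigtriangledown$ is parenthesised according to one fixed associativity convention. The function $\mathsf{explain}$ (recursive on the length of $\mathsf{unions}\ ufe$). $\mathsf{explain}\ ufe\ x\ y=\mathsf{ReflP}\ x$ if $\mathsf{unions}\ ufe=[\,]$.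 Otherwise let $ufe_0=\mathsf{rollback}\ ufe$, let $(a,b)$ be the last element of $\mathsf{unions}\ ufe$, and $q=\mathsf{AssmP}\ |\mathsf{unions}\ ufe_0|$. Then $\mathsf{explain}\ ufe\ x\ y$ is: - $\mathsf{explain}\ ufe_0\ x\ y$, if $\mathsf{ufe\_rep\_of}\ ufe_0\ x=\mathsf{ufe\_rep\_of}\ ufe_0\ y$; - else $\mathsf{explain}\ ufe_0\ x\ a\bigtriangledown q\bigtriangledown\mathsf{explain}\ ufe_0\ b\ y$, if $\mathsf{ufe\_rep\_of}\ ufe_0\ x=\mathsf{ufe\_rep\_of}\ ufe_0\ a$; - else $\mathsf{explain}\ ufe_0\ x\ b\bigtriangledown\mathsf{SymP}\ q\bigtriangledown\mathsf{explain}\ ufe_0\ a\ y$. -}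

module Defs where

open import Data.Bool.Base using (if_then_else_)
open import Data.Fin.Base using (Fin; zero; suc; toℕ; fromℕ<)
open import Data.Fin.Properties using (toℕ-fromℕ<)
open import Data.List.Base using (List; []; _∷_; _∷ʳ_; length; lookup; foldl; _[_]∷=_)
open import Data.List.Membership.Propositional using (_∈_)
open import Data.List.Properties using (length-∷=)
open import Data.List.Reverse using (Reverse; []; _∶_∶ʳ_; reverseView)
open import Data.Nat.Base using (ℕ; zero; suc; _<_; z<s; s<s)
open import Data.Nat.Properties using (_≟_; _<?_)
open import Data.Product.Base using (∃-syntax; _×_; _,_; proj₁; proj₂)
open import Data.Sum.Base using (_⊎_)
open import Data.Unit.Base using (⊤; tt)
open import Level using (0ℓ)
open import Relation.Binary.Construct.Closure.Equivalence using (EqClosure)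
open import Relation.Binary.Core using (Rel; _⇒_)
open import Relation.Binary.PropositionalEquality
  using (_≡_; _≢_; refl; sym; cong; subst)
open import Relation.Nullary using (does; yes; no; contradiction)

infix 4 _[_]=_

record _[_]=_ {A : Set} (xs : List A) (i : ℕ) (x : A) : Set where
  constructor at
  field
    in-range : i < length xs
    lookup-≡ : lookup xs (fromℕ< in-range) ≡ x

open _[_]=_ public

-- RootOf l i j: following parents in l from i leads to j, and j is a root.
data RootOf (l : List ℕ) : ℕ → ℕ → Set where
  root : ∀ {i} → l [ i ]= i → RootOf l i i
  step : ∀ {i p j} → l [ i ]= p → RootOf l p j → RootOf l i j

record UF : Set where
  constructor mkUF
  field
    parents : List ℕ
    bounded : ∀ {i p} → parents [ i ]= p → p < length parents
    rooted  : ∀ {i} → i < length parents → ∃[ j ] RootOf parents i j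

open UF public

size : UF → ℕ
size uf = length (parents uf)

root-isRoot : ∀ {l i j} → RootOf l i j → l [ j ]= j
root-isRoot (root e)   = e
root-isRoot (step _ r) = root-isRoot r

[]=-∷-suc : ∀ {A : Set} {xs : List A} {i x y} → xs [ i ]= x → (y ∷ xs) [ suc i ]= x
[]=-∷-suc (at i<n eq) = at (s<s i<n) eq

[]∷=-at : ∀ {A : Set} (xs : List A) k {v} → (xs [ k ]∷= v) [ toℕ k ]= v
[]∷=-at (x ∷ xs) zero    = at z<s refl
[]∷=-at (x ∷ xs) (suc k) = []=-∷-suc ([]∷=-at xs k)

[]∷=-off : ∀ {A : Set} (xs : List A) k {v i x} → i ≢ toℕ k →
           xs [ i ]= x → (xs [ k ]∷= v) [ i ]= x
[]∷=-off (x ∷ xs) zero    {i = zero}  i≢k _                 = contradiction refl i≢k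
[]∷=-off (x ∷ xs) zero    {i = suc i} i≢k (at (s<s i<n) eq) = at (s<s i<n) eq
[]∷=-off (x ∷ xs) (suc k) {i = zero}  i≢k (at _ eq)         = at z<s eq
[]∷=-off (x ∷ xs) (suc k) {i = suc i} i≢k (at (s<s i<n) eq) =
  []=-∷-suc ([]∷=-off xs k (λ i≡k → i≢k (cong suc i≡k)) (at i<n eq))

[]=-functional : ∀ {A : Set} {xs : List A} {i x y} → xs [ i ]= x → xs [ i ]= y → x ≡ y
[]=-functional (at _ refl) (at _ refl) = refl

[]=-total : ∀ {A : Set} (xs : List A) {i} → i < length xs → ∃[ x ] xs [ i ]= x
[]=-total xs i<n = _ , at i<n refl

module _ (l : List ℕ) (k : Fin (length l)) (r : ℕ) where

  private
    l′ = l [ k ]∷= r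

  link-bounded : (∀ {i p} → l [ i ]= p → p < length l) → r < length l →
                 ∀ {i p} → l′ [ i ]= p → p < length l′
  link-bounded bnd r<n {i} e with i ≟ toℕ k
  ... | yes refl rewrite []=-functional e ([]∷=-at l k) =
        subst (r <_) (sym (length-∷= l k r)) r<n
  ... | no i≢k with []=-total l (subst (i <_) (length-∷= l k r) (in-range e))
  ...   | _ , e′ rewrite []=-functional e ([]∷=-off l k i≢k e′) =
          subst (_ <_) (sym (length-∷= l k r)) (bnd e′)

  link-target : l [ r ]= r → l′ [ r ]= r
  link-target er with r ≟ toℕ k
  ... | yes r≡k = subst (l′ [_]= r) (sym r≡k) ([]∷=-at l k)
  ... | no r≢k  = []∷=-off l k r≢k er

  link-rooted : l [ r ]= r → ∀ {i j} → RootOf l i j → ∃[ j′ ] RootOf l′ i j′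
  link-rooted er {i} ro with i ≟ toℕ k
  link-rooted er _          | yes refl = r , step ([]∷=-at l k) (root (link-target er))
  link-rooted er (root e)   | no i≢k   = _ , root ([]∷=-off l k i≢k e)
  link-rooted er (step e s) | no i≢k   with link-rooted er s
  ... | j′ , s′ = j′ , step ([]∷=-off l k i≢k e) s′

link : (uf : UF) → ∀ {i r} → i < size uf → parents uf [ r ]= r → UF
link (mkUF l bnd rtd) {r = r} i<n er = mkUF (l [ k ]∷= r)
    (link-bounded l k r bnd (in-range er))
    (λ j<n → link-rooted l k r er
               (proj₂ (rtd (subst (_ <_) (length-∷= l k r) j<n))))
  where k = fromℕ< i<n

Field : Rel ℕ 0ℓ → ℕ → Set
Field R x = (∃[ y ] R x y) ⊎ (∃[ y ] R y x)

setRel : List (ℕ × ℕ) → Rel ℕ 0ℓ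
setRel us x y = (x , y) ∈ us

equivcl : Rel ℕ 0ℓ → Rel ℕ 0ℓ
equivcl = EqClosure

infixr 6 _▽_
infix 3 _⊢₌_∶_

data Proof : Set where
  AssmP : ℕ → Proof
  ReflP : ℕ → Proof
  SymP  : Proof → Proof
  _▽_   : Proof → Proof → Proof

data _⊢₌_∶_ (us : List (ℕ × ℕ)) : Proof → ℕ × ℕ → Set where
  ⊢-assm  : ∀ {i x y} → us [ i ]= (x , y) → us ⊢₌ AssmP i ∶ (x , y)
  ⊢-refl  : ∀ {x} → us ⊢₌ ReflP x ∶ (x , x)
  ⊢-sym   : ∀ {p x y} → us ⊢₌ p ∶ (x , y) → us ⊢₌ SymP p ∶ (y , x)
  ⊢-trans : ∀ {p₁ p₂ x y z} → us ⊢₌ p₁ ∶ (x , y) → us ⊢₌ p₂ ∶ (y , z) →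
            us ⊢₌ p₁ ▽ p₂ ∶ (x , z)

-- The parameter supplies the unspecified values of ufa-rep-of outside the domain.
module UnionFind (unspecified : List ℕ → ℕ → ℕ) where

  ufa-rep-of : UF → ℕ → ℕ
  ufa-rep-of uf i with i <? size uf
  ... | yes i<n = proj₁ (rooted uf i<n)
  ... | no  _   = unspecified (parents uf) i

  ufa-rep-of-isRoot : ∀ uf {i} → i < size uf → parents uf [ ufa-rep-of uf i ]= ufa-rep-of uf i
  ufa-rep-of-isRoot uf {i} i<n with i <? size uf
  ... | yes i<n′ = root-isRoot (proj₂ (rooted uf i<n′))
  ... | no  i≮n  = contradiction i<n i≮n

  ufa-α : UF → Rel ℕ 0ℓ
  ufa-α uf x y = x < size uf × y < size uf × ufa-rep-of uf x ≡ ufa-rep-of uf y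

  -- The value uf for x or y out of range is a dummy.
  ufa-union : UF → ℕ → ℕ → UF
  ufa-union uf x y with x <? size uf | y <? size uf
  ... | yes x<n | yes y<n =
        link uf {i = ufa-rep-of uf x} {r = ufa-rep-of uf y}
             (in-range (ufa-rep-of-isRoot uf x<n)) (ufa-rep-of-isRoot uf y<n)
  ... | _       | _       = uf

  ufa-unions : UF → List (ℕ × ℕ) → UF
  ufa-unions = foldl (λ uf (x , y) → ufa-union uf x y)

  eff-union : UF → ℕ → ℕ → Set
  eff-union uf a b =
    Field (ufa-α uf) a × Field (ufa-α uf) b × ufa-rep-of uf a ≢ ufa-rep-of uf b

  eff-unions : UF → List (ℕ × ℕ) → Set
  eff-unions uf []             = ⊤
  eff-unions uf ((a , b) ∷ us) = eff-union uf a b × eff-unions (ufa-union uf a b) us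

  eff-unions-init : ∀ uf us {u} → eff-unions uf (us ∷ʳ u) → eff-unions uf us
  eff-unions-init uf []       _        = tt
  eff-unions-init uf (_ ∷ us) (e , es) = e , eff-unions-init _ us es

  record UFE : Set where
    constructor mkUFE
    field
      uf        : UF
      unions    : List (ℕ × ℕ)
      discrete  : ufa-α uf ⇒ _≡_
      effective : eff-unions uf unions

  open UFE public using (unions)

  uf-ds : UFE → UF
  uf-ds ufe = ufa-unions (UFE.uf ufe) (unions ufe)

  ufe-rep-of : UFE → ℕ → ℕ
  ufe-rep-of ufe = ufa-rep-of (uf-ds ufe)

  rollback-view : (ufe : UFE) → Reverse (unions ufe) → UFE
  rollback-view ufe                []            = ufe
  rollback-view (mkUFE uf _ d eff) (us ∶ _ ∶ʳ _) = mkUFE uf us d (eff-unions-init uf us eff)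

  rollback : UFE → UFE
  rollback ufe = rollback-view ufe (reverseView (unions ufe))

  -- Recursion is on the view of the list of unions from its last element.
  explain-view : (ufe : UFE) → Reverse (unions ufe) → ℕ → ℕ → Proof
  explain-view ufe [] x y = ReflP x
  explain-view ufe@(mkUFE _ _ _ _) v@(us ∶ rs ∶ʳ (a , b)) x y =
    if does (rep x ≟ rep y) then
      explain-view ufe₀ rs x y
    else if does (rep x ≟ rep a) then
      explain-view ufe₀ rs x a ▽ q ▽ explain-view ufe₀ rs b y
    else
      explain-view ufe₀ rs x b ▽ SymP q ▽ explain-view ufe₀ rs a y
    where
    ufe₀ = rollback-view ufe v
    rep  = ufe-rep-of ufe₀
    q    = AssmP (length (unions ufe₀))

  explain : UFE → ℕ → ℕ → Proof
  explain ufe = explain-view ufe (reverseView (unions ufe))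

{-# OPTIONS --safe #-}

-- By induction on the unions, x and y in range have equal representatives as soon as they are
-- related by the closure: a union only ever redirects one class to another, so it merges classes
-- and never splits them. Conversely, if the last union (a , b) made the representatives of x and y
-- equal, then before it one of x, y was in the class of a and the other in the class of b, which
-- is the case distinction of explain. Out of range the closure is the identity, and
-- explain x x never leaves its first branch.
module Submission where

open import Defs
open import Data.Bool.Base using (if_then_else_)
open import Data.Fin.Base using (Fin; toℕ)
open import Data.Fin.Properties using (toℕ-fromℕ<)
open import Data.List.Base using (List; []; _∷_; _∷ʳ_; length; _[_]∷=_)
open import Data.List.Properties using (length-∷=; foldl-∷ʳ)
open import Data.List.Relation.Unary.Any using (here; there)
open import Data.List.Reverse using (Reverse; []; _∶_∶ʳ_; reverseView)
open import Data.Nat.Base using (ℕ; zero; suc; _<_; z<s; s<s)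
open import Data.Nat.Properties using (_≟_; _<?_)
open import Data.Product.Base using (_×_; _,_; proj₁; proj₂; map₂)
open import Data.Sum.Base as Sum using (_⊎_; inj₁; inj₂)
open import Function.Base using (_∘_)
open import Relation.Binary.Construct.Closure.Equivalence using (fold)
open import Relation.Binary.Construct.Closure.Reflexive using (ReflClosure; refl; [_])
import Relation.Binary.Construct.Closure.Reflexive.Properties as Refl
open import Relation.Binary.PropositionalEquality
  using (_≡_; _≢_; refl; sym; trans; cong; subst)
open import Relation.Binary.Structures using (IsEquivalence)
open import Relation.Nullary using (Dec; does; yes; no; ¬_; contradiction)

[]=-∷ʳ : ∀ {A : Set} {xs : List A} {i x y} → xs [ i ]= x → (xs ∷ʳ y) [ i ]= x
[]=-∷ʳ {xs = _ ∷ _} {zero}  (at _ eq) = at z<s eq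
[]=-∷ʳ {xs = _ ∷ _} {suc i} (at (s<s i<n) eq) = []=-∷-suc ([]=-∷ʳ (at i<n eq))

[]=-last : ∀ {A : Set} (xs : List A) {x} → (xs ∷ʳ x) [ length xs ]= x
[]=-last []       = at z<s refl
[]=-last (_ ∷ xs) = []=-∷-suc ([]=-last xs)

-- Assumptions are cited by their position from the front, so appending a pair at the end leaves
-- every citation valid. This carries the proofs found after `rollback` over to the full list.
⊢-weaken : ∀ {us u p e} → us ⊢₌ p ∶ e → us ∷ʳ u ⊢₌ p ∶ e
⊢-weaken (⊢-assm e)    = ⊢-assm ([]=-∷ʳ e)
⊢-weaken ⊢-refl        = ⊢-refl
⊢-weaken (⊢-sym d)     = ⊢-sym (⊢-weaken d)
⊢-weaken (⊢-trans d e) = ⊢-trans (⊢-weaken d) (⊢-weaken e)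

⊢-if : ∀ {P : Set} {us p q e} (P? : Dec P) → (P → us ⊢₌ p ∶ e) → (¬ P → us ⊢₌ q ∶ e) →
       us ⊢₌ if does P? then p else q ∶ e
⊢-if (yes p) t f = t p
⊢-if (no ¬p) t f = f ¬p

RootOf-root : ∀ {l i j} → l [ i ]= i → RootOf l i j → i ≡ j
RootOf-root e (root _)    = refl
RootOf-root e (step e′ s) with refl ← []=-functional e e′ = RootOf-root e s

-- A derivation may `step` around the self-loop at a root any number of times, so derivations
-- differ, but by `RootOf-root` none can leave the root.
RootOf-unique : ∀ {l i j k} → RootOf l i j → RootOf l i k → j ≡ k
RootOf-unique (root e)   t           = RootOf-root e t
RootOf-unique (step e s) (root e′)   = sym (RootOf-root e′ (step e s))
RootOf-unique (step e s) (step e′ t) with refl ← []=-functional e e′ = RootOf-unique s t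

-- Since `r` is a root, a path that meets `r` ends there. Hence redirecting `r` to `s` prolongs
-- exactly the paths ending at `r` and leaves every entry on the others unchanged.
RootOf-link : ∀ {l} {k : Fin (length l)} {r s i j} → toℕ k ≡ r → l [ r ]= r → l [ s ]= s →
              RootOf l i j →
              (j ≡ r × RootOf (l [ k ]∷= s) i s) ⊎ (j ≢ r × RootOf (l [ k ]∷= s) i j)
RootOf-link {l} {k} {s = s} {i} refl r-root s-root i→j with i ≟ toℕ k
... | yes refl =
  inj₁ (sym (RootOf-root r-root i→j) , step ([]∷=-at l k) (root (link-target l k s s-root)))
... | no i≢k with i→j
...   | root e     = inj₂ (i≢k , root ([]∷=-off l k i≢k e))
...   | step e p→j =
  Sum.map (map₂ (step e′)) (map₂ (step e′)) (RootOf-link refl r-root s-root p→j)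
  where e′ = []∷=-off l k i≢k e

module _ (unspecified : List ℕ → ℕ → ℕ) where
  open UnionFind unspecified

  RootOf-rep : ∀ uf {i} → i < size uf → RootOf (parents uf) i (ufa-rep-of uf i)
  RootOf-rep uf {i} i<n with i <? size uf
  ... | yes i<n′ = proj₂ (rooted uf i<n′)
  ... | no  i≮n  = contradiction i<n i≮n

  Field⇒< : ∀ uf {a} → Field (ufa-α uf) a → a < size uf
  Field⇒< _ (inj₁ (_ , a<n , _))     = a<n
  Field⇒< _ (inj₂ (_ , _ , a<n , _)) = a<n

  size-union : ∀ uf a b → size (ufa-union uf a b) ≡ size uf
  size-union uf a b with a <? size uf | b <? size uf
  ... | yes _ | yes _ = length-∷= (parents uf) _ _
  ... | yes _ | no  _ = refl
  ... | no  _ | _     = refl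

  -- Here `r` and `s` are variables tied to `a` and `b` only by derivations, which keeps
  -- `ufa-rep-of` out of the statement while `with` evaluates `ufa-union`; uniqueness then
  -- identifies them with the linked representatives.
  RootOf-union : ∀ uf {a b i r s j} → let l = parents uf; l′ = parents (ufa-union uf a b) in
                 a < size uf → b < size uf → RootOf l a r → RootOf l b s → RootOf l i j →
                 (j ≡ r × RootOf l′ i s) ⊎ (j ≢ r × RootOf l′ i j)
  RootOf-union uf {a} {b} a<n b<n a→r b→s i→j with a <? size uf | b <? size uf
  ... | yes _   | yes _
    with refl ← RootOf-unique a→r (RootOf-rep uf a<n)
       | refl ← RootOf-unique b→s (RootOf-rep uf b<n) =
    RootOf-link (toℕ-fromℕ< _) (root-isRoot a→r) (root-isRoot b→s) i→j
  ... | yes _   | no  b≮n = contradiction b<n b≮n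
  ... | no  a≮n | _       = contradiction a<n a≮n

  rep-union : ∀ uf {a b i} → a < size uf → b < size uf → i < size uf →
              let rep = ufa-rep-of uf; rep′ = ufa-rep-of (ufa-union uf a b) in
              (rep i ≡ rep a × rep′ i ≡ rep b) ⊎ (rep i ≢ rep a × rep′ i ≡ rep i)
  rep-union uf {a} {b} {i} a<n b<n i<n =
    Sum.map (map₂ (RootOf-unique i→rep′)) (map₂ (RootOf-unique i→rep′))
      (RootOf-union uf a<n b<n (RootOf-rep uf a<n) (RootOf-rep uf b<n) (RootOf-rep uf i<n))
    where
    i→rep′ = RootOf-rep (ufa-union uf a b) (subst (i <_) (sym (size-union uf a b)) i<n)

  module _ (uf : UF) {a b : ℕ} (a<n : a < size uf) (b<n : b < size uf) where

    private
      rep  = ufa-rep-of uf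
      rep′ = ufa-rep-of (ufa-union uf a b)

      widen : ∀ {i} → i < size uf → i < size (ufa-union uf a b)
      widen = subst (_ <_) (sym (size-union uf a b))

    -- By `rep-union` the old representative determines the new one; the mixed cases would put only
    -- one of two equivalent elements in the class of `a`.
    α-union-mono : ∀ {x y} → ufa-α uf x y → ufa-α (ufa-union uf a b) x y
    α-union-mono {x} {y} (x<n , y<n , eq) = widen x<n , widen y<n , rep′-eq
      where
      rep′-eq : rep′ x ≡ rep′ y
      rep′-eq with rep-union uf a<n b<n x<n | rep-union uf a<n b<n y<n
      ... | inj₁ (_ , p) | inj₁ (_ , q) = trans p (sym q)
      ... | inj₁ (e , _) | inj₂ (n , _) = contradiction (trans (sym eq) e) n
      ... | inj₂ (n , _) | inj₁ (e , _) = contradiction (trans eq e) n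
      ... | inj₂ (_ , p) | inj₂ (_ , q) = trans p (trans eq (sym q))

    α-union-pair : ufa-α (ufa-union uf a b) a b
    α-union-pair = widen a<n , widen b<n , trans rep′-a (sym rep′-b)
      where
      rep′-a : rep′ a ≡ rep b
      rep′-a with rep-union uf a<n b<n a<n
      ... | inj₁ (_ , p) = p
      ... | inj₂ (n , _) = contradiction refl n
      rep′-b : rep′ b ≡ rep b
      rep′-b with rep-union uf a<n b<n b<n
      ... | inj₁ (_ , p) = p
      ... | inj₂ (_ , p) = p

    -- Exactly one of `x` and `y` lay in the class of `a`; the other kept its representative, which
    -- must therefore be `rep b`. The two components provide what the recursive calls in the last
    -- two branches of `explain` require.
    rep-union-inv : ∀ {x y} → x < size uf → y < size uf → rep′ x ≡ rep′ y → rep x ≢ rep y →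
                    (rep x ≡ rep a → rep b ≡ rep y) ×
                    (rep x ≢ rep a → rep x ≡ rep b × rep a ≡ rep y)
    rep-union-inv x<n y<n eq x≢y with rep-union uf a<n b<n x<n | rep-union uf a<n b<n y<n
    ... | inj₁ (e , _) | inj₁ (f , _) = contradiction (trans e (sym f)) x≢y
    ... | inj₁ (e , p) | inj₂ (_ , q) =
          (λ _ → trans (sym p) (trans eq q)) , λ n → contradiction e n
    ... | inj₂ (n , p) | inj₁ (f , q) =
          (λ e → contradiction e n) , λ _ → trans (sym p) (trans eq q) , sym f
    ... | inj₂ (_ , p) | inj₂ (_ , q) = contradiction (trans (sym p) (trans eq q)) x≢y

  α-unions-mono : ∀ uf us {x y} → eff-unions uf us → ufa-α uf x y → ufa-α (ufa-unions uf us) x y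
  α-unions-mono uf []       _                    r = r
  α-unions-mono uf (_ ∷ us) ((fa , fb , _) , es) r =
    α-unions-mono _ us es (α-union-mono uf (Field⇒< uf fa) (Field⇒< uf fb) r)

  -- A pair becomes related when its own union is performed, and later unions preserve this.
  setRel⇒α : ∀ uf us {x y} → eff-unions uf us → setRel us x y → ufa-α (ufa-unions uf us) x y
  setRel⇒α uf (_ ∷ us) ((fa , fb , _) , es) (here refl) =
    α-unions-mono _ us es (α-union-pair uf (Field⇒< uf fa) (Field⇒< uf fb))
  setRel⇒α uf (_ ∷ us) (_ , es) (there u∈us) = setRel⇒α _ us es u∈us

  -- `equivcl` is reflexive on all of ℕ but `ufa-α` only on indices in range; `ReflClosure` supplies
  -- the missing diagonal.
  equivcl⇒α : ∀ ufe {x y} → equivcl (setRel (unions ufe)) x y → ReflClosure (ufa-α (uf-ds ufe)) x y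
  equivcl⇒α (mkUFE uf us _ eff) = fold isEquiv ([_] ∘ setRel⇒α uf us eff)
    where
    isEquiv : IsEquivalence (ReflClosure (ufa-α (ufa-unions uf us)))
    isEquiv = record
      { refl  = refl
      ; sym   = Refl.sym λ (x<n , y<n , eq) → y<n , x<n , sym eq
      ; trans = Refl.trans λ (x<n , _ , eq) (_ , z<n , eq′) → x<n , z<n , trans eq eq′
      }

  eff-unions-last : ∀ uf us {a b} → eff-unions uf (us ∷ʳ (a , b)) → eff-union (ufa-unions uf us) a b
  eff-unions-last uf []       (e , _)  = e
  eff-unions-last uf (_ ∷ us) (_ , es) = eff-unions-last _ us es

  -- The first test compares a representative with itself, so it succeeds whatever `unspecified`
  -- returns.
  explain-view-refl : ∀ ufe (v : Reverse (unions ufe)) x →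
                      unions ufe ⊢₌ explain-view ufe v x x ∶ (x , x)
  explain-view-refl ufe [] x = ⊢-refl
  explain-view-refl ufe@(mkUFE _ _ _ _) v@(_ ∶ rs ∶ʳ _) x =
    ⊢-if (ufe-rep-of (rollback-view ufe v) x ≟ ufe-rep-of (rollback-view ufe v) x)
      (λ _ → ⊢-weaken (explain-view-refl (rollback-view ufe v) rs x))
      (λ n → contradiction refl n)

  explain-view-sound : ∀ ufe (v : Reverse (unions ufe)) {x y} → ufa-α (uf-ds ufe) x y →
                       unions ufe ⊢₌ explain-view ufe v x y ∶ (x , y)
  -- Before any union all classes are singletons, so `x` and `y` coincide.
  explain-view-sound ufe [] r with refl ← UFE.discrete ufe r = ⊢-refl
  explain-view-sound ufe@(mkUFE uf _ _ eff) v@(us ∶ rs ∶ʳ (a , b)) {x} {y} (x<n′ , y<n′ , eq′) =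
    ⊢-if (rep x ≟ rep y) (sound x<n y<n) λ x≁y →
    let case-a , case-b = rep-union-inv uf₀ a<n b<n x<n y<n eq x≁y in
    ⊢-if (rep x ≟ rep a)
      (λ x~a → ⊢-trans (sound x<n a<n x~a) (⊢-trans q (sound b<n y<n (case-a x~a))))
      (λ x≁a → let x~b , a~y = case-b x≁a in
        ⊢-trans (sound x<n b<n x~b) (⊢-trans (⊢-sym q) (sound a<n y<n a~y)))
    where
    ufe₀ = rollback-view ufe v
    uf₀  = uf-ds ufe₀
    rep  = ufa-rep-of uf₀

    ds-eq : uf-ds ufe ≡ ufa-union uf₀ a b
    ds-eq = foldl-∷ʳ _ uf (a , b) us

    narrow : ∀ {i} → i < size (uf-ds ufe) → i < size uf₀
    narrow = subst (_ <_) (trans (cong size ds-eq) (size-union uf₀ a b))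

    last-eff = eff-unions-last uf us eff
    a<n = Field⇒< uf₀ (proj₁ last-eff)
    b<n = Field⇒< uf₀ (proj₁ (proj₂ last-eff))
    x<n = narrow x<n′
    y<n = narrow y<n′

    eq : ufa-rep-of (ufa-union uf₀ a b) x ≡ ufa-rep-of (ufa-union uf₀ a b) y
    eq = subst (λ u → ufa-rep-of u x ≡ ufa-rep-of u y) ds-eq eq′

    -- Counting from 0, `length us` is the position of the appended pair.
    q : us ∷ʳ (a , b) ⊢₌ AssmP (length us) ∶ (a , b)
    q = ⊢-assm ([]=-last us)

    sound : ∀ {i j} → i < size uf₀ → j < size uf₀ → rep i ≡ rep j →
            us ∷ʳ (a , b) ⊢₌ explain-view ufe₀ rs i j ∶ (i , j)
    sound i<n j<n i~j = ⊢-weaken (explain-view-sound ufe₀ rs (i<n , j<n , i~j))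

theorem2 : (unspecified : List ℕ → ℕ → ℕ) → let open UnionFind unspecified in
    (ufe : UFE) (x y : ℕ) →
    equivcl (setRel (unions ufe)) x y →
    unions ufe ⊢₌ explain ufe x y ∶ (x , y)
theorem2 unspecified ufe x y x~y with equivcl⇒α unspecified ufe x~y
-- Nothing is known here about the range of `x`.
... | refl  = explain-view-refl unspecified ufe (reverseView (UnionFind.unions ufe)) x
... | [ r ] = explain-view-sound unspecified ufe (reverseView (UnionFind.unions ufe)) r
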